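{- Let $r\in\mathbb N$, let $M$ be the sub-add move matrix, and let $\Delta$ be the subgraph of $\Gamma_{M,\,2^r}$ induced on $V(\Gamma_{M,\,2^r})\setminus\{(0,0)\}$. Then $\Delta$ is an inverted $PBT_d$ of depth $d=2r-1$. Moreover, $\Gamma_{M,\,2^r}$ is obtained from $\Delta$ by adding the vertex $(0,0)$ together with the two arcs $((2^{r-1},2^{r-1}),(0,0))$ and $((0,0),(0,0))$.
   Context: The sub-add move matrix is $M=\begin{pmatrix}1&-1\\1&1\end{pmatrix}$. For $n\in\mathbb N$, $\Gamma_{M,\,n}$ is the directed graph with vertex set $\mathbb Z_n^2$ and arcs $((a,b),(a-b,a+b))$ for all $(a,b)\in\mathbb Z_n^2$ (computed mod $n$; loops allowed). A perfect binary tree $PBT_d$ is a rooted binary tree in which every non-leaf node has exactly two children and all leaves are at the same depth $d$; it is regarded as directed so that there is a unique directed path from the root (the unique parentless node) to each leaf. It is called inverted if the orientation of every arc is reversed. -}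

module Defs where

open import Level using (0ℓ)
open import Data.Nat.Base using (ℕ; NonZero)
open import Data.Integer.Base using (ℤ; +_; 1ℤ; -1ℤ; _+_; _*_; _%ℕ_)
open import Data.Integer.DivMod using (n%ℕd<d)
open import Data.Fin.Base using (Fin; toℕ; fromℕ<)
open import Data.List.Base using (List; []; _∷_; length)
import Data.List.Membership.Propositional as List
open import Data.Product using (_×_; _,_; ∃; ∃₂; ∃!; proj₁; proj₂; swap)
open import Relation.Nullary using (¬_)
open import Relation.Unary using (Pred; U; _∈_; _∉_; _⊆_; _≐_; _∪_; _∩_; ｛_｝)
open import Relation.Binary.PropositionalEquality using (_≡_; _≢_)

-- Loops are allowed. Vertex sets and arc sets are subsets of an ambient type,
-- so that they may be compared by _≐_; only inhabitation of `arcs (u , v)`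
-- matters, i.e. there are no parallel arcs.
record Digraph (X : Set) : Set₁ where
  field
    vertices : Pred X 0ℓ
    arcs     : Pred (X × X) 0ℓ
    incident : ∀ {u v} → (u , v) ∈ arcs → u ∈ vertices × v ∈ vertices

open Digraph public

module _ {X : Set} where

  reverse : Digraph X → Digraph X
  reverse G .vertices = vertices G
  reverse G .arcs     = λ e → swap e ∈ arcs G
  reverse G .incident = λ a → swap (incident G a)

  induced : Digraph X → Pred X 0ℓ → Digraph X
  induced G S .vertices = vertices G ∩ S
  induced G S .arcs     = arcs G ∩ λ (u , v) → u ∈ S × v ∈ S
  induced G S .incident (a , u∈S , v∈S) =
    (proj₁ (incident G a) , u∈S) , (proj₂ (incident G a) , v∈S)

  -- The list holds the vertices visited after the first one, so its length is
  -- the number of arcs traversed.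
  data Walk (G : Digraph X) : X → X → List X → Set where
    stop : ∀ {v} → v ∈ vertices G → Walk G v v []
    step : ∀ {u v w vs} → (u , v) ∈ arcs G → Walk G v w vs → Walk G u w (v ∷ vs)

  Parentless : Digraph X → Pred X 0ℓ
  Parentless G v = v ∈ vertices G × (∀ u → (u , v) ∉ arcs G)

  Leaf : Digraph X → Pred X 0ℓ
  Leaf G v = v ∈ vertices G × (∀ w → (v , w) ∉ arcs G)

  record IsPBT (d : ℕ) (G : Digraph X) : Set where
    field
      finite       : ∃ λ vs → vertices G ⊆ (List._∈ vs)
      root         : X
      root-unique  : Parentless G ≐ ｛ root ｝
      -- Uniqueness is among walks, not only among paths without repeated
      -- vertices: this makes G a tree oriented away from its root, with no
      -- directed cycles and exactly one parent for every other vertex.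
      unique-walk  : ∀ {v} → v ∈ vertices G → ∃! _≡_ (Walk G root v)
      two-children : ∀ {v} → v ∈ vertices G → ¬ Leaf G v →
                     ∃₂ λ c₁ c₂ → c₁ ≢ c₂ ×
                       (λ c → (v , c) ∈ arcs G) ≐ (｛ c₁ ｝ ∪ ｛ c₂ ｝)
      leaf-depth   : ∀ {v vs} → Leaf G v → Walk G root v vs → length vs ≡ d

  IsInvertedPBT : ℕ → Digraph X → Set
  IsInvertedPBT d G = IsPBT d (reverse G)

  record ObtainedByAdding (H G : Digraph X) (w : X) (A : Pred (X × X) 0ℓ) : Set where
    field
      fresh      : w ∉ vertices G
      vertices-≐ : vertices H ≐ (vertices G ∪ ｛ w ｝)
      arcs-≐     : arcs H ≐ (arcs G ∪ A)

-- Rows of a 2 × 2 integer matrix.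
Matrix₂ : Set
Matrix₂ = (ℤ × ℤ) × (ℤ × ℤ)

subAdd : Matrix₂
subAdd = (1ℤ , -1ℤ) ,
         (1ℤ ,  1ℤ)

-- ℤ modulo n is represented by Fin n.
module _ (n : ℕ) .{{_ : NonZero n}} where

  residue : ℤ → Fin n
  residue i = fromℕ< (n%ℕd<d i n)

  -- M times the column vector (a , b): for subAdd, (a - b , a + b) modulo n.
  move : Matrix₂ → Fin n × Fin n → Fin n × Fin n
  move ((p , q) , (s , t)) (a , b) =
    residue (p * + toℕ a + q * + toℕ b) , residue (s * + toℕ a + t * + toℕ b)

  -- The point (k , k) of the square of ℤ modulo n.
  diagonal : ℕ → Fin n × Fin n
  diagonal k = residue (+ k) , residue (+ k)

Γ : Matrix₂ → (n : ℕ) .{{_ : NonZero n}} → Digraph (Fin n × Fin n)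
Γ M n .vertices = U
Γ M n .arcs     = λ (u , v) → move n M u ≡ v
Γ M n .incident = λ _ → _

{-# OPTIONS --safe #-}
-- Multiplication by 1 + i on ℤ[i]/2ʳ is the move, and 2 is a unit times
-- (1 + i)². The fibre of the move over a point is empty when the coordinate
-- sum is odd and a coset of {(0,0), (2ʳ⁻¹,2ʳ⁻¹)} otherwise. Since the square
-- of the move is twice a rotation, a point with odd coordinate sum reaches
-- (2ʳ⁻¹,2ʳ⁻¹) after exactly 2r - 1 moves, and every point reaches (0,0) after
-- 2r moves.
module Submission where

open import Defs
open import Data.Empty using (⊥-elim)
open import Data.Fin.Base using (Fin; toℕ; fromℕ<)
open import Data.Fin.Properties as Fin
  using (fromℕ<-cong; fromℕ<-injective; fromℕ<-toℕ; toℕ<n)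
open import Data.Integer.Base as ℤ using (ℤ; +_; 0ℤ; 1ℤ; -1ℤ; _%ℕ_; _/ℕ_)
open import Data.Integer.Divisibility.Signed
  using (_∣_; divides; ∣⇒∣ᵤ; ∣-trans; ∣m∣n⇒∣m+n; ∣m∣n⇒∣m-n)
open import Data.Integer.DivMod using (a≡a%ℕn+[a/ℕn]*n; n%ℕd<d)
import Data.Integer.Properties as ℤ
open import Data.Integer.Tactic.RingSolver using (solve-∀)
open import Data.List.Base using (List; []; _∷_; length; allFin; cartesianProduct)
import Data.List.Membership.Propositional as List
open import Data.List.Membership.Propositional.Properties
  using (∈-cartesianProduct⁺; ∈-allFin)
open import Data.Nat.Base as ℕ
  using (ℕ; zero; suc; _*_; _∸_; _^_; _<_; NonZero; s≤s; z≤n)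
open import Data.Nat.Divisibility using (>⇒∤)
open import Data.Nat.DivMod using (m<n⇒m%n≡m)
open import Data.Nat.GeneralisedArithmetic using (fold)
open import Data.Nat.Properties as ℕ using (m^n≢0)
open import Data.Product using (_×_; _,_; ∃; ∃₂; ∃!; proj₁; proj₂; map)
open import Data.Product.Properties using (≡-dec; ,-injective)
open import Data.Sum using (_⊎_; inj₁; inj₂; [_,_]′)
open import Function.Base using (id; _∘_)
open import Relation.Binary.Definitions using (DecidableEquality; tri<; tri≈; tri>)
open import Relation.Binary.PropositionalEquality
open import Relation.Nullary using (¬_; yes; no; contradiction)
open import Relation.Unary using (∁; ｛_｝; _∪_; _≐_; U; _∈_)

-- Inverted trees from a map with an absorbing fixed point.

functional : {X : Set} → (X → X) → Digraph X
functional f .vertices = U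
functional f .arcs     = λ (u , v) → f u ≡ v
functional f .incident = λ _ → _

module FunctionalTree
  {X : Set} (_≟_ : DecidableEquality X) (f : X → X) {o root : X}
  (f-o : f o ≡ o) (f-root : f root ≡ o) (o≢root : o ≢ root)
  (f-kernel : ∀ {u} → f u ≡ o → o ≡ u ⊎ root ≡ u)
  where

  Δ T : Digraph X
  Δ = induced (functional f) (∁ ｛ o ｝)
  T = reverse Δ

  -- The list runs from late iterates back to `v` because `T` reverses the arcs, and it omits
  -- `fold v f k` just as `Walk` omits its first vertex.
  trajectory : X → ℕ → List X
  trajectory v zero    = []
  trajectory v (suc k) = fold v f k ∷ trajectory v k

  o≢fu⇒o≢u : ∀ {u} → o ≢ f u → o ≢ u
  o≢fu⇒o≢u o≢fu refl = o≢fu (sym f-o)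

  trajectory-walk : ∀ v k → o ≢ fold v f k → Walk T (fold v f k) v (trajectory v k)
  trajectory-walk v zero    o≢v = stop (_ , o≢v)
  trajectory-walk v (suc k) o≢f =
    step (refl , o≢fu⇒o≢u o≢f , o≢f) (trajectory-walk v k (o≢fu⇒o≢u o≢f))

  -- The only arc of T into v comes from f v, so a walk is determined by its end
  -- point and its length.
  walk⇒trajectory : ∀ {u v vs} → Walk T u v vs →
                    fold v f (length vs) ≡ u × trajectory v (length vs) ≡ vs
  walk⇒trajectory (stop _) = refl , refl
  walk⇒trajectory (step (refl , _) w) with walk⇒trajectory w
  ... | eq , eqs = cong f eq , cong₂ _∷_ eq eqs

  root-walk : ∀ {v} k → fold v f k ≡ root → Walk T root v (trajectory v k)
  root-walk {v} k eq = subst (λ u → Walk T u v (trajectory v k)) eq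
    (trajectory-walk v k (subst (o ≢_) (sym eq) o≢root))

  root⇒later-o : ∀ {v k l} → fold v f k ≡ root → k < l → fold v f l ≡ o
  root⇒later-o {l = suc l} eq (s≤s k≤l) with ℕ.m≤n⇒m<n∨m≡n k≤l
  ... | inj₁ k<l  = trans (cong f (root⇒later-o eq k<l)) f-o
  ... | inj₂ refl = trans (cong f eq) f-root

  -- Right after `root` the trajectory is absorbed by `o`, which differs from `root`, so no second
  -- visit is possible. Both the uniqueness of walks and the common depth of leaves rest on this.
  root-time-unique : ∀ {v k l} → fold v f k ≡ root → fold v f l ≡ root → k ≡ l
  root-time-unique {v} {k} {l} p q with ℕ.<-cmp k l
  ... | tri≈ _ k≡l _ = k≡l
  ... | tri< k<l _ _ = contradiction (trans (sym (root⇒later-o p k<l)) q) o≢root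
  ... | tri> _ _ l<k = contradiction (trans (sym (root⇒later-o q l<k)) p) o≢root

  -- Going back from a time spent at `o`, `f-kernel` leaves only `o` or `root` as the preceding
  -- point; it cannot be `o` all the way down to the start `v`.
  reaches-root : ∀ {v} k → o ≢ v → fold v f k ≡ o → ∃ λ l → fold v f l ≡ root
  reaches-root zero    o≢v eq = contradiction (sym eq) o≢v
  reaches-root (suc k) o≢v eq with f-kernel eq
  ... | inj₁ o≡ = reaches-root k o≢v (sym o≡)
  ... | inj₂ r≡ = k , sym r≡

  -- The depth of a vertex is the time it takes to reach `root`. Nilpotency makes every vertex other
  -- than `o` pass through `root`, `childless` fixes that time for the leaves, and `fibre` supplies
  -- the branching.
  isInvertedPBT :
    (vs : List X) → (∀ v → v List.∈ vs) →
    (d : ℕ) → (∀ v → fold v f (suc d) ≡ o) →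
    (∀ v → (∀ w → f w ≢ v) → fold v f d ≡ root) →
    (∀ v → (∀ w → f w ≢ v) ⊎
           ∃₂ λ c₁ c₂ → c₁ ≢ c₂ × (λ c → f c ≡ v) ≐ (｛ c₁ ｝ ∪ ｛ c₂ ｝)) →
    IsInvertedPBT d Δ
  isInvertedPBT vs ∈vs d nilpotent childless fibre = record
    { finite       = vs , λ {v} _ → ∈vs v
    ; root         = root
    ; root-unique  = parentless⇒root , λ { refl → root-parentless }
    ; unique-walk  = unique
    ; two-children = children
    ; leaf-depth   = λ {v} {vs} leaf w →
        root-time-unique {v} (proj₁ (walk⇒trajectory w))
          (childless v (leaf-childless leaf))
    }
    where
    -- The only candidate for a parent of `v` in `T` is `f v`, which is missing exactly when it is
    -- the deleted vertex `o`.
    parentless⇒root : ∀ {v} → Parentless T v → root ≡ v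
    parentless⇒root {v} ((_ , o≢v) , no-parent) with f v ≟ o
    ... | no fv≢o = ⊥-elim (no-parent (f v) (refl , o≢v , ≢-sym fv≢o))
    ... | yes fv≡o = [ ⊥-elim ∘ o≢v , id ]′ (f-kernel fv≡o)

    root-parentless : Parentless T root
    root-parentless = (_ , o≢root) , λ u (eq , _ , o≢u) → o≢u (trans (sym f-root) eq)

    unique : ∀ {v} → v ∈ vertices T → ∃! _≡_ (Walk T root v)
    unique {v} (_ , o≢v) with reaches-root (suc d) o≢v (nilpotent v)
    ... | k , eq = trajectory v k , root-walk k eq , λ {us} w →
      let eq′ , eqs = walk⇒trajectory w in
      trans (cong (trajectory v) (root-time-unique {v} eq eq′)) eqs

    leaf-childless : ∀ {v} → Leaf T v → ∀ w → f w ≢ v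
    leaf-childless ((_ , o≢v) , no-child) w refl =
      no-child w (refl , o≢fu⇒o≢u o≢v , o≢v)

    children : ∀ {v} → v ∈ vertices T → ¬ Leaf T v →
               ∃₂ λ c₁ c₂ → c₁ ≢ c₂ ×
                 (λ c → (v , c) ∈ arcs T) ≐ (｛ c₁ ｝ ∪ ｛ c₂ ｝)
    children {v} (_ , o≢v) ¬leaf with fibre v
    ... | inj₁ none = ⊥-elim (¬leaf ((_ , o≢v) , λ w a → none w (proj₁ a)))
    ... | inj₂ (c₁ , c₂ , c₁≢c₂ , ⊆₁ , ⊆₂) =
      c₁ , c₂ , c₁≢c₂ , (λ a → ⊆₁ (proj₁ a)) ,
      -- Deleting `o` costs `v` no child: `o` is a preimage of `o` alone, and `v` is not `o`.
      λ c∈ → ⊆₂ c∈ , o≢fu⇒o≢u (subst (o ≢_) (sym (⊆₂ c∈)) o≢v) , o≢v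

  obtainedByAdding :
    ObtainedByAdding (functional f) Δ o (｛ (root , o) ｝ ∪ ｛ (o , o) ｝)
  obtainedByAdding = record
    { fresh      = λ (_ , o≢o) → o≢o refl
    ; vertices-≐ = (λ {v} _ → split v) , λ _ → _
    ; arcs-≐     = (λ {e} → forth e) ,
        λ { (inj₁ (eq , _))     → eq
          ; (inj₂ (inj₁ refl)) → f-root
          ; (inj₂ (inj₂ refl)) → f-o }
    }
    where
    split : ∀ v → v ∈ (vertices Δ ∪ ｛ o ｝)
    split v with o ≟ v
    ... | yes o≡v = inj₂ o≡v
    ... | no  o≢v = inj₁ (_ , o≢v)

    forth : ∀ e → e ∈ arcs (functional f) →
            e ∈ (arcs Δ ∪ (｛ (root , o) ｝ ∪ ｛ (o , o) ｝))
    forth (u , _) refl with o ≟ f u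
    ... | no o≢fu = inj₁ (refl , o≢fu⇒o≢u o≢fu , o≢fu)
    ... | yes o≡fu with f-kernel (sym o≡fu)
    ...   | inj₁ refl = inj₂ (inj₂ (cong (o ,_) o≡fu))
    ...   | inj₂ refl = inj₂ (inj₁ (cong (root ,_) o≡fu))

-- Residues modulo `n` and their integer representatives.

module _ (n : ℕ) .{{_ : NonZero n}} where

  n∣i-i%n : ∀ i → + n ∣ i ℤ.- + (i %ℕ n)
  n∣i-i%n i = divides (i /ℕ n)
    (trans (cong (ℤ._- + (i %ℕ n)) (a≡a%ℕn+[a/ℕn]*n i n))
      (cancel (+ (i %ℕ n)) (i /ℕ n ℤ.* + n)))
    where
    cancel : ∀ a b → a ℤ.+ b ℤ.- a ≡ b
    cancel = solve-∀

  -- The absolute difference is at most the larger of `a` and `b`, hence below `n`, and the only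
  -- multiple of `n` in that range is zero.
  small∧∣⇒≡ : ∀ {a b} → a < n → b < n → + n ∣ + a ℤ.- + b → a ≡ b
  small∧∣⇒≡ {a} {b} a<n b<n n∣ with ℤ.∣ + a ℤ.- + b ∣ in eq | ∣⇒∣ᵤ n∣
  ... | zero  | _   = ℤ.+-injective (ℤ.i-j≡0⇒i≡j _ _ (ℤ.∣i∣≡0⇒i≡0 eq))
  ... | suc m | n∣m = contradiction n∣m (>⇒∤ (subst (_< n) abs bound))
    where
    abs : ℤ.∣ a ℤ.⊖ b ∣ ≡ suc m
    abs = trans (cong ℤ.∣_∣ (sym (ℤ.m-n≡m⊖n a b))) eq
    bound : ℤ.∣ a ℤ.⊖ b ∣ < n
    bound = ℕ.≤-<-trans (ℤ.∣m⊝n∣≤m⊔n a b) (ℕ.⊔-lub a<n b<n)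

  residue-cong : ∀ i j → + n ∣ i ℤ.- j → residue n i ≡ residue n j
  residue-cong i j n∣ = fromℕ<-cong _ _
    (small∧∣⇒≡ (n%ℕd<d i n) (n%ℕd<d j n)
      (subst (+ n ∣_) (shuffle i j _ _)
        (∣m∣n⇒∣m-n (∣m∣n⇒∣m+n n∣ (n∣i-i%n j)) (n∣i-i%n i)))) _ _
    where
    shuffle : ∀ i j a b → i ℤ.- j ℤ.+ (j ℤ.- b) ℤ.- (i ℤ.- a) ≡ a ℤ.- b
    shuffle = solve-∀

  residue-injective : ∀ i j → residue n i ≡ residue n j → + n ∣ i ℤ.- j
  residue-injective i j eq = subst (+ n ∣_) (shuffle i j (+ (i %ℕ n)))
    (∣m∣n⇒∣m-n (n∣i-i%n i) (subst (λ a → + n ∣ j ℤ.- + a)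
      (sym (fromℕ<-injective _ _ (n%ℕd<d i n) (n%ℕd<d j n) eq)) (n∣i-i%n j)))
    where
    shuffle : ∀ i j a → (i ℤ.- a) ℤ.- (j ℤ.- a) ≡ i ℤ.- j
    shuffle = solve-∀

  residue-toℕ : ∀ a → residue n (+ toℕ a) ≡ a
  residue-toℕ a = trans (fromℕ<-cong _ _ (m<n⇒m%n≡m (toℕ<n a)) _ (toℕ<n a))
                        (fromℕ<-toℕ a (toℕ<n a))

  point : ℤ × ℤ → Fin n × Fin n
  point = map (residue n) (residue n)

  point-cong : ∀ ((x , y) (x′ , y′) : ℤ × ℤ) → + n ∣ x ℤ.- x′ → + n ∣ y ℤ.- y′ →
               point (x , y) ≡ point (x′ , y′)
  point-cong (x , y) (x′ , y′) p q =
    cong₂ _,_ (residue-cong x x′ p) (residue-cong y y′ q)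

  point-injective : ∀ ((x , y) (x′ , y′) : ℤ × ℤ) → point (x , y) ≡ point (x′ , y′) →
                    + n ∣ x ℤ.- x′ × + n ∣ y ℤ.- y′
  point-injective (x , y) (x′ , y′) eq =
    map (residue-injective x x′) (residue-injective y y′) (,-injective eq)

  -- A view: matching on it replaces a pair of residues by integer representatives, which turns
  -- equations between points into divisibility statements open to ring identities.
  data Point : Fin n × Fin n → Set where
    pt : ∀ x y → Point (point (x , y))

  toPoint : ∀ v → Point v
  toPoint (a , b) = subst Point (cong₂ _,_ (residue-toℕ a) (residue-toℕ b))
                                (pt (+ toℕ a) (+ toℕ b))

-- The move lifted to integer representatives.

F : ℤ × ℤ → ℤ × ℤ
F (x , y) = x ℤ.- y , x ℤ.+ y

module _ (n : ℕ) .{{_ : NonZero n}} where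

  move-point : ∀ p → move n subAdd (point n p) ≡ point n (F p)
  move-point p@(x , y) = point-cong n
    (1ℤ ℤ.* a ℤ.+ -1ℤ ℤ.* b , 1ℤ ℤ.* a ℤ.+ 1ℤ ℤ.* b) (F p)
    (subst (+ n ∣_) (difference x y a b) (∣m∣n⇒∣m-n (n∣i-toℕ y) (n∣i-toℕ x)))
    (subst (+ n ∣_) (sum x y a b)
      -- The required difference is minus the sum of the two reduction errors, so the subtraction
      -- starts from zero.
      (∣m∣n⇒∣m-n (∣m∣n⇒∣m-n (divides 0ℤ refl) (n∣i-toℕ x)) (n∣i-toℕ y)))
    where
    a b : ℤ
    a = + toℕ (residue n x)
    b = + toℕ (residue n y)
    n∣i-toℕ : ∀ i → + n ∣ i ℤ.- + toℕ (residue n i)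
    n∣i-toℕ i = residue-injective n i (+ toℕ (residue n i))
      (sym (residue-toℕ n (residue n i)))
    difference : ∀ x y a b →
      (y ℤ.- b) ℤ.- (x ℤ.- a) ≡ (1ℤ ℤ.* a ℤ.+ -1ℤ ℤ.* b) ℤ.- (x ℤ.- y)
    difference = solve-∀
    sum : ∀ x y a b →
      0ℤ ℤ.- (x ℤ.- a) ℤ.- (y ℤ.- b) ≡ (1ℤ ℤ.* a ℤ.+ 1ℤ ℤ.* b) ℤ.- (x ℤ.+ y)
    sum = solve-∀

  fold-move-point : ∀ p k → fold (point n p) (move n subAdd) k ≡ point n (fold p F k)
  fold-move-point p zero    = refl
  fold-move-point p (suc k) =
    trans (cong (move n subAdd) (fold-move-point p k)) (move-point (fold p F k))

-- Parity of integers.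

Odd : ℤ → Set
Odd i = ∃ λ k → i ≡ 1ℤ ℤ.+ k ℤ.* + 2

parity : ∀ i → + 2 ∣ i ⊎ Odd i
parity i with i %ℕ 2 | n%ℕd<d i 2 | a≡a%ℕn+[a/ℕn]*n i 2
... | 0           | _             | eq =
  inj₁ (divides (i /ℕ 2) (trans eq (ℤ.+-identityˡ _)))
... | 1           | _             | eq =
  inj₂ (i /ℕ 2 , eq)
... | suc (suc _) | s≤s (s≤s ()) | _

odd⇒2∤ : ∀ {i} → Odd i → ¬ (+ 2 ∣ i)
odd⇒2∤ (k , refl) 2∣i = >⇒∤ (s≤s (s≤s z≤n)) (∣⇒∣ᵤ 2∣1)
  where
  cancel : ∀ k → 1ℤ ℤ.+ k ℤ.* + 2 ℤ.- k ℤ.* + 2 ≡ 1ℤ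
  cancel = solve-∀
  2∣1 : + 2 ∣ 1ℤ
  2∣1 = subst (+ 2 ∣_) (cancel k) (∣m∣n⇒∣m-n 2∣i (divides k refl))

-- Kernel and fibres of the move modulo an even number `2 * h`.

module Fibres (h : ℕ) .{{_ : NonZero h}} .{{_ : NonZero (2 * h)}} where

  n : ℕ
  n = 2 * h

  H : ℤ
  H = + h

  f : Fin n × Fin n → Fin n × Fin n
  f = move n subAdd

  o half : Fin n × Fin n
  o    = diagonal n 0
  half = diagonal n h

  n≡2H : + n ≡ + 2 ℤ.* H
  n≡2H = ℤ.pos-* 2 h

  n∣q*2H : ∀ {i} q → i ≡ q ℤ.* (+ 2 ℤ.* H) → + n ∣ i
  n∣q*2H q eq = divides q (trans eq (cong (q ℤ.*_) (sym n≡2H)))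

  -- With `x - y = 2pH` and `x + y = 2qH`, adding and halving gives `x = (p + q)H`. The parity of
  -- `p + q` decides whether `x` is `0` or `H` modulo `n`, and `y` follows from `x - y`.
  kernel : ∀ x y → + n ∣ x ℤ.- y → + n ∣ x ℤ.+ y →
           (+ n ∣ x × + n ∣ y) ⊎ (+ n ∣ x ℤ.- H × + n ∣ y ℤ.- H)
  kernel x y (divides p x-y≡) (divides q x+y≡) with parity (p ℤ.+ q)
    | ℤ.*-cancelʳ-≡ x ((p ℤ.+ q) ℤ.* H) (+ 2)
        (trans (twice x y) (trans (cong₂ ℤ._+_ x-y≡pH2 x+y≡qH2) (factor p q H)))
    where
    x-y≡pH2 : x ℤ.- y ≡ p ℤ.* (+ 2 ℤ.* H)
    x-y≡pH2 = trans x-y≡ (cong (p ℤ.*_) n≡2H)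
    x+y≡qH2 : x ℤ.+ y ≡ q ℤ.* (+ 2 ℤ.* H)
    x+y≡qH2 = trans x+y≡ (cong (q ℤ.*_) n≡2H)
    twice : ∀ x y → x ℤ.* + 2 ≡ (x ℤ.- y) ℤ.+ (x ℤ.+ y)
    twice = solve-∀
    factor : ∀ p q H →
      p ℤ.* (+ 2 ℤ.* H) ℤ.+ q ℤ.* (+ 2 ℤ.* H) ≡ (p ℤ.+ q) ℤ.* H ℤ.* + 2
    factor = solve-∀
  ... | inj₁ (divides k p+q≡) | x≡ =
    inj₁ (n∣x , subst (+ n ∣_) (subtract x y) (∣m∣n⇒∣m-n n∣x (divides p x-y≡)))
    where
    regroup : ∀ k H → k ℤ.* + 2 ℤ.* H ≡ k ℤ.* (+ 2 ℤ.* H)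
    regroup = solve-∀
    n∣x : + n ∣ x
    n∣x = n∣q*2H k (trans x≡ (trans (cong (ℤ._* H) p+q≡) (regroup k H)))
    subtract : ∀ x y → x ℤ.- (x ℤ.- y) ≡ y
    subtract = solve-∀
  ... | inj₂ (k , p+q≡) | x≡ =
    inj₂ (n∣x-H , subst (+ n ∣_) (subtract x y H) (∣m∣n⇒∣m-n n∣x-H (divides p x-y≡)))
    where
    regroup : ∀ k H → (1ℤ ℤ.+ k ℤ.* + 2) ℤ.* H ℤ.- H ≡ k ℤ.* (+ 2 ℤ.* H)
    regroup = solve-∀
    n∣x-H : + n ∣ x ℤ.- H
    n∣x-H = n∣q*2H k
      (trans (cong (ℤ._- H) (trans x≡ (cong (ℤ._* H) p+q≡))) (regroup k H))
    subtract : ∀ x y H → x ℤ.- H ℤ.- (x ℤ.- y) ≡ y ℤ.- H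
    subtract = solve-∀

  -- By linearity the difference of two points with equal image lies in the kernel. The equations
  -- point towards `(a , b)` so that they are literally membership in a union of two singletons.
  fibre-coset : ∀ a b c d → f (point n (a , b)) ≡ f (point n (c , d)) →
                point n (c , d) ≡ point n (a , b) ⊎
                point n (c ℤ.+ H , d ℤ.+ H) ≡ point n (a , b)
  fibre-coset a b c d eq = [ inj₁ ∘ same , inj₂ ∘ translated ]′
    (kernel (a ℤ.- c) (b ℤ.- d)
      (subst (+ n ∣_) (difference a b c d) (proj₁ n∣))
      (subst (+ n ∣_) (sum a b c d) (proj₂ n∣)))
    where
    n∣ : + n ∣ a ℤ.- b ℤ.- (c ℤ.- d) × + n ∣ a ℤ.+ b ℤ.- (c ℤ.+ d)
    n∣ = point-injective n (F (a , b)) (F (c , d))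
      (trans (sym (move-point n (a , b))) (trans eq (move-point n (c , d))))
    difference : ∀ a b c d → a ℤ.- b ℤ.- (c ℤ.- d) ≡ (a ℤ.- c) ℤ.- (b ℤ.- d)
    difference = solve-∀
    sum : ∀ a b c d → a ℤ.+ b ℤ.- (c ℤ.+ d) ≡ (a ℤ.- c) ℤ.+ (b ℤ.- d)
    sum = solve-∀
    shift : ∀ a c H → a ℤ.- c ℤ.- H ≡ a ℤ.- (c ℤ.+ H)
    shift = solve-∀
    same : + n ∣ a ℤ.- c × + n ∣ b ℤ.- d → point n (c , d) ≡ point n (a , b)
    same (p , q) = sym (point-cong n (a , b) (c , d) p q)
    translated : + n ∣ a ℤ.- c ℤ.- H × + n ∣ b ℤ.- d ℤ.- H →
                 point n (c ℤ.+ H , d ℤ.+ H) ≡ point n (a , b)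
    translated (p , q) = sym (point-cong n (a , b) (c ℤ.+ H , d ℤ.+ H)
      (subst (+ n ∣_) (shift a c H) p) (subst (+ n ∣_) (shift b d H) q))

  f-translate : ∀ a b → f (point n (a ℤ.+ H , b ℤ.+ H)) ≡ f (point n (a , b))
  f-translate a b = trans (move-point n p) (trans
    (point-cong n (F p) (F (a , b))
      (divides 0ℤ (difference a b H)) (n∣q*2H 1ℤ (sum a b H)))
    (sym (move-point n (a , b))))
    where
    p : ℤ × ℤ
    p = a ℤ.+ H , b ℤ.+ H
    difference : ∀ a b H → (a ℤ.+ H) ℤ.- (b ℤ.+ H) ℤ.- (a ℤ.- b) ≡ 0ℤ
    difference = solve-∀
    sum : ∀ a b H → (a ℤ.+ H) ℤ.+ (b ℤ.+ H) ℤ.- (a ℤ.+ b) ≡ 1ℤ ℤ.* (+ 2 ℤ.* H)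
    sum = solve-∀

  translate-≢ : ∀ a b → point n (a , b) ≢ point n (a ℤ.+ H , b ℤ.+ H)
  translate-≢ a b eq = >⇒∤ h<n (∣⇒∣ᵤ n∣H)
    where
    n∣H : + n ∣ H
    n∣H = subst (+ n ∣_) (cancel a H)
      (proj₁ (point-injective n (a ℤ.+ H , b ℤ.+ H) (a , b) (sym eq)))
      where
      cancel : ∀ a H → a ℤ.+ H ℤ.- a ≡ H
      cancel = solve-∀
    h<n : h < n
    h<n = ℕ.m<m+n h (subst (0 <_) (sym (ℕ.+-identityʳ h)) (ℕ.>-nonZero⁻¹ h))

  f-o : f o ≡ o
  f-o = move-point n (0ℤ , 0ℤ)

  o≢half : o ≢ half
  -- `0ℤ + H` computes to `H`, so the translate of `o` is `half` by definition.
  o≢half = translate-≢ 0ℤ 0ℤ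

  f-half : f half ≡ o
  f-half = trans (f-translate 0ℤ 0ℤ) f-o

  f-kernel : ∀ {u} → f u ≡ o → o ≡ u ⊎ half ≡ u
  f-kernel {u} eq with toPoint n u
  ... | pt a b = fibre-coset a b 0ℤ 0ℤ (trans eq (sym f-o))

  -- The coordinates of an image `(a - b , a + b)` sum to `2a`, and reduction modulo the even number
  -- `n` preserves parity.
  odd⇒childless : ∀ x y → Odd (x ℤ.+ y) → ∀ w → f w ≢ point n (x , y)
  odd⇒childless x y odd w eq with toPoint n w
  ... | pt a b = odd⇒2∤ odd (subst (+ 2 ∣_) (rearrange a b x y)
      (∣m∣n⇒∣m-n (divides a refl) (∣-trans 2∣n (∣m∣n⇒∣m+n (proj₁ n∣) (proj₂ n∣)))))
    where
    n∣ : + n ∣ a ℤ.- b ℤ.- x × + n ∣ a ℤ.+ b ℤ.- y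
    n∣ = point-injective n (F (a , b)) (x , y) (trans (sym (move-point n (a , b))) eq)
    2∣n : + 2 ∣ + n
    2∣n = divides H (trans n≡2H (ℤ.*-comm (+ 2) H))
    rearrange : ∀ a b x y →
      a ℤ.* + 2 ℤ.- ((a ℤ.- b ℤ.- x) ℤ.+ (a ℤ.+ b ℤ.- y)) ≡ x ℤ.+ y
    rearrange = solve-∀

  even⇒two-children : ∀ x y → + 2 ∣ x ℤ.+ y →
    ∃₂ λ c₁ c₂ → c₁ ≢ c₂ × (λ c → f c ≡ point n (x , y)) ≐ (｛ c₁ ｝ ∪ ｛ c₂ ｝)
  even⇒two-children x y (divides k x+y≡2k) =
    -- Solving `a - b = x` and `a + b = y` over the integers gives `a = k`, half of `x + y`, and
    -- `b = k - x`. The other child is the translate by `(H , H)`.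
    point n (k , k ℤ.- x) , point n (k ℤ.+ H , k ℤ.- x ℤ.+ H) ,
    translate-≢ k (k ℤ.- x) ,
    (λ {c} → only c) ,
    λ { (inj₁ refl) → f-child
      ; (inj₂ refl) → trans (f-translate k (k ℤ.- x)) f-child }
    where
    first : ∀ k x → k ℤ.- (k ℤ.- x) ≡ x
    first = solve-∀
    second : ∀ k x → k ℤ.+ (k ℤ.- x) ≡ k ℤ.* + 2 ℤ.- x
    second = solve-∀
    subtract : ∀ x y → x ℤ.+ y ℤ.- x ≡ y
    subtract = solve-∀
    f-child : f (point n (k , k ℤ.- x)) ≡ point n (x , y)
    f-child = trans (move-point n (k , k ℤ.- x)) (cong (point n) (cong₂ _,_ (first k x)
      (trans (second k x) (trans (cong (ℤ._- x) (sym x+y≡2k)) (subtract x y)))))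
    only : ∀ c → f c ≡ point n (x , y) →
           c ∈ (｛ point n (k , k ℤ.- x) ｝ ∪ ｛ point n (k ℤ.+ H , k ℤ.- x ℤ.+ H) ｝)
    only c eq with toPoint n c
    ... | pt a b = fibre-coset a b k (k ℤ.- x) (trans eq (sym f-child))

  fibre : ∀ v → (∀ w → f w ≢ v) ⊎
          ∃₂ λ c₁ c₂ → c₁ ≢ c₂ × (λ c → f c ≡ v) ≐ (｛ c₁ ｝ ∪ ｛ c₂ ｝)
  fibre v with toPoint n v
  ... | pt x y = [ inj₂ ∘ even⇒two-children x y , inj₁ ∘ odd⇒childless x y ]′
                   (parity (x ℤ.+ y))

  childless⇒odd : ∀ x y → (∀ w → f w ≢ point n (x , y)) → Odd (x ℤ.+ y)
  childless⇒odd x y none = [ ⊥-elim ∘ not-even , id ]′ (parity (x ℤ.+ y))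
    where
    not-even : ¬ (+ 2 ∣ x ℤ.+ y)
    not-even even = let c , _ , _ , _ , ⊇ = even⇒two-children x y even in
      none c (⊇ (inj₁ refl))

  -- The image is `H` times `(x - y , x + y)`. Both factors are odd, as they differ by `2y`, and an
  -- odd multiple of `H` is `H` modulo `2H`.
  F-odd : ∀ x y → Odd (x ℤ.+ y) → point n (F (H ℤ.* x , H ℤ.* y)) ≡ half
  F-odd x y (k , x+y≡) = point-cong n (F (H ℤ.* x , H ℤ.* y)) (H , H)
    (n∣q*2H (k ℤ.- y) (trans (difference H x y) (trans
      (cong (λ z → H ℤ.* (z ℤ.- 1ℤ ℤ.- + 2 ℤ.* y)) x+y≡) (difference′ H k y))))
    (n∣q*2H k (trans (sum H x y) (trans
      (cong (λ z → H ℤ.* (z ℤ.- 1ℤ)) x+y≡) (sum′ H k))))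
    where
    difference : ∀ H x y →
      H ℤ.* x ℤ.- H ℤ.* y ℤ.- H ≡ H ℤ.* (x ℤ.+ y ℤ.- 1ℤ ℤ.- + 2 ℤ.* y)
    difference = solve-∀
    difference′ : ∀ H k y →
      H ℤ.* (1ℤ ℤ.+ k ℤ.* + 2 ℤ.- 1ℤ ℤ.- + 2 ℤ.* y) ≡ (k ℤ.- y) ℤ.* (+ 2 ℤ.* H)
    difference′ = solve-∀
    sum : ∀ H x y → H ℤ.* x ℤ.+ H ℤ.* y ℤ.- H ≡ H ℤ.* (x ℤ.+ y ℤ.- 1ℤ)
    sum = solve-∀
    sum′ : ∀ H k → H ℤ.* (1ℤ ℤ.+ k ℤ.* + 2 ℤ.- 1ℤ) ≡ k ℤ.* (+ 2 ℤ.* H)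
    sum′ = solve-∀

-- Even iterates of the lifted move.

fold-F-even : ∀ p j → ∃₂ λ x y →
  fold p F (j * 2) ≡ (+ (2 ^ j) ℤ.* x , + (2 ^ j) ℤ.* y) ×
  (Odd (proj₁ p ℤ.+ proj₂ p) → Odd (x ℤ.+ y))
fold-F-even (x , y) zero = x , y ,
  cong₂ _,_ (sym (ℤ.*-identityˡ x)) (sym (ℤ.*-identityˡ y)) , id
fold-F-even p (suc j) with fold-F-even p j
... | x , y , eq , odd = ℤ.- y , x ,
  -- `suc j * 2` computes to two further applications of `F`. Together they send `(x , y)` to
  -- `(-2y , 2x)`, which contributes one more factor 2 and a quarter turn.
  trans (cong (F ∘ F) eq) (cong₂ _,_
    (trans (first (+ (2 ^ j)) x y) (cong (ℤ._* ℤ.- y) (sym (ℤ.pos-* 2 (2 ^ j)))))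
    (trans (second (+ (2 ^ j)) x y) (cong (ℤ._* x) (sym (ℤ.pos-* 2 (2 ^ j)))))) ,
  rotate ∘ odd
  where
  first : ∀ c x y →
    (c ℤ.* x ℤ.- c ℤ.* y) ℤ.- (c ℤ.* x ℤ.+ c ℤ.* y) ≡ + 2 ℤ.* c ℤ.* (ℤ.- y)
  first = solve-∀
  second : ∀ c x y →
    (c ℤ.* x ℤ.- c ℤ.* y) ℤ.+ (c ℤ.* x ℤ.+ c ℤ.* y) ≡ + 2 ℤ.* c ℤ.* x
  second = solve-∀
  -- The quarter turn keeps the parity of the coordinate sum, which changes by `2y`.
  rotate : Odd (x ℤ.+ y) → Odd (ℤ.- y ℤ.+ x)
  rotate (k , x+y≡) = k ℤ.- y ,
    trans (swap-sign x y) (trans (cong (ℤ._- y ℤ.* + 2) x+y≡) (regroup k y))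
    where
    swap-sign : ∀ x y → ℤ.- y ℤ.+ x ≡ x ℤ.+ y ℤ.- y ℤ.* + 2
    swap-sign = solve-∀
    regroup : ∀ k y → 1ℤ ℤ.+ k ℤ.* + 2 ℤ.- y ℤ.* + 2 ≡ 1ℤ ℤ.+ (k ℤ.- y) ℤ.* + 2
    regroup = solve-∀

-- Arrival times at `o` and `half` for the modulus `2 ^ suc s`.

module PowerOfTwo (s : ℕ) where

  instance
    2^s≢0 : NonZero (2 ^ s)
    2^s≢0 = m^n≢0 2 s
    2^1+s≢0 : NonZero (2 ^ suc s)
    2^1+s≢0 = m^n≢0 2 (suc s)

  open Fibres (2 ^ s) public

  -- After `suc s` pairs of moves the extracted power of two is `n` itself.
  nilpotent : ∀ v → fold v f (suc s * 2) ≡ o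
  nilpotent v with toPoint n v
  ... | pt x y =
    let x′ , y′ , eq , _ = fold-F-even (x , y) (suc s) in
    trans (fold-move-point n (x , y) (suc s * 2)) (trans (cong (point n) eq)
      (point-cong n (+ n ℤ.* x′ , + n ℤ.* y′) (0ℤ , 0ℤ) (n∣n*x x′) (n∣n*x y′)))
    where
    n∣n*x : ∀ x → + n ∣ + n ℤ.* x ℤ.- 0ℤ
    n∣n*x x = divides x (trans (ℤ.+-identityʳ _) (ℤ.*-comm (+ n) x))

  -- After `s` pairs of moves the point is `H` times a pair whose coordinate sum is still odd; the
  -- one remaining move is `F-odd`.
  childless⇒reaches-half : ∀ v → (∀ w → f w ≢ v) → fold v f (suc (s * 2)) ≡ half
  childless⇒reaches-half v none with toPoint n v
  ... | pt x y =
    let x′ , y′ , eq , odd = fold-F-even (x , y) s in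
    trans (fold-move-point n (x , y) (suc (s * 2)))
      (trans (cong (point n ∘ F) eq) (F-odd x′ y′ (odd (childless⇒odd x y none))))

  depth-≡ : suc (s * 2) ≡ 2 * suc s ∸ 1
  depth-≡ = cong (_∸ 1) (ℕ.*-comm (suc s) 2)

theorem5p6 : (r : ℕ) .{{_ : NonZero r}} →
    let instance 2^r≢0 : NonZero (2 ^ r)
                 2^r≢0 = m^n≢0 2 r
        Γ₂ʳ  = Γ subAdd (2 ^ r)
        o    = diagonal (2 ^ r) 0
        half = diagonal (2 ^ r) (2 ^ (r ∸ 1))
        Δ    = induced Γ₂ʳ (∁ ｛ o ｝)
    in IsInvertedPBT (2 * r ∸ 1) Δ
       × ObtainedByAdding Γ₂ʳ Δ o (｛ (half , o) ｝ ∪ ｛ (o , o) ｝)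
-- `Γ subAdd n` agrees with `functional f` field by field, and `2 ^ suc s` unfolds to `2 * 2 ^ s`,
-- so only the depth has to be transported.
theorem5p6 (suc s) = subst (λ d → IsInvertedPBT d Δ) depth-≡ tree , obtainedByAdding
  where
  open PowerOfTwo s
  open FunctionalTree (≡-dec Fin._≟_ Fin._≟_) f f-o f-half o≢half f-kernel

  tree : IsInvertedPBT (suc (s * 2)) Δ
  tree = isInvertedPBT (cartesianProduct (allFin n) (allFin n))
    (λ (a , b) → ∈-cartesianProduct⁺ (∈-allFin a) (∈-allFin b))
    (suc (s * 2)) nilpotent childless⇒reaches-half fibre
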